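{- Let $C\subset\mathbb{R}^d$ be a full-dimensional pointed rational cone, let $x_1,\dots,x_n$ be its Hilbert basis and $\sigma_1,\dots,\sigma_s$ its support forms. Then the map sending $\phi\in\operatorname{Aut}_{\mathbb{Z}} C$ to the permutation $\Pi\in\mathcal{S}_n$ with $\phi(x_i)=x_{\Pi(i)}$ for all $i$ identifies $\operatorname{Aut}_{\mathbb{Z}} C$ with the group of permutations $\Pi\in\mathcal{S}_n$ for which there exists a permutation $\Sigma\in\mathcal{S}_s$ such that $$\sigma_{\Sigma(j)}(x_{\Pi(i)})=\sigma_j(x_i),\qquad i=1,\dots,n,\ j=1,\dots,s.$$
   Context: $\operatorname{Aut}_{\mathbb{Z}} C$ is the group of linear automorphisms of $\mathbb{R}^d$ with integral matrix and integral inverse mapping $C$ onto itself. The Hilbert basis is the unique minimal generating set of the monoid $C\cap\mathbb{Z}^d$. The support forms are the primitive integral linear forms generating the extreme rays of the dual cone $C^*$. $\mathcal{S}_n$ is the symmetric group on $\{1,\dots,n\}$. -}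

module Defs where

open import Data.Nat using (ℕ; zero; suc)
open import Data.Integer using (ℤ; +_; _+_; _*_; -_; _≤_; _<_; 0ℤ; 1ℤ)
open import Data.Integer.Divisibility using (_∣_)
open import Data.Fin using (Fin; zero; suc)
open import Data.Fin.Subset using (Subset; _∈_; _∉_)
open import Data.Fin.Permutation using (Permutation′; _⟨$⟩ʳ_)
open import Data.Product using (Σ; _×_; ∃)
open import Relation.Binary.PropositionalEquality using (_≡_)
open import Relation.Nullary using (¬_)

Vecℤ : ℕ → Set
Vecℤ d = Fin d → ℤ

∑ : ∀ {n} → (Fin n → ℤ) → ℤ
∑ {zero}  f = 0ℤ
∑ {suc n} f = f zero + ∑ (λ i → f (suc i))

_·_ : ∀ {d} → Vecℤ d → Vecℤ d → ℤ
y · x = ∑ (λ i → y i * x i)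

Matℤ : ℕ → Set
Matℤ d = Fin d → Fin d → ℤ

_*v_ : ∀ {d} → Matℤ d → Vecℤ d → Vecℤ d
(A *v v) i = ∑ (λ j → A i j * v j)

δ : ∀ {d} → Fin d → Fin d → ℤ
δ zero    zero    = 1ℤ
δ zero    (suc j) = 0ℤ
δ (suc i) zero    = 0ℤ
δ (suc i) (suc j) = δ i j

IsInverse : ∀ {d} → Matℤ d → Matℤ d → Set
IsInverse A B = (∀ i k → ∑ (λ j → A i j * B j k) ≡ δ i k)
              × (∀ i k → ∑ (λ j → B i j * A j k) ≡ δ i k)

-- A rational cone C = { x | ℓ_k(x) ≥ 0 for all k } given by finitely many
-- integral linear forms ℓ : Fin m → Vecℤ d.  We only need its lattice points.
InCone : ∀ {d m} → (Fin m → Vecℤ d) → Vecℤ d → Set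
InCone ℓ x = ∀ k → 0ℤ ≤ ℓ k · x

Pointed : ∀ {d m} → (Fin m → Vecℤ d) → Set
Pointed ℓ = ∀ x → InCone ℓ x → InCone ℓ (λ i → - x i) → ∀ i → x i ≡ 0ℤ

-- Full-dimensional: the only linear form vanishing on C is zero
-- (i.e. the linear span of C is the whole space).
FullDim : ∀ {d m} → (Fin m → Vecℤ d) → Set
FullDim ℓ = ∀ y → (∀ x → InCone ℓ x → y · x ≡ 0ℤ) → ∀ i → y i ≡ 0ℤ

InDual : ∀ {d m} → (Fin m → Vecℤ d) → Vecℤ d → Set
InDual ℓ y = ∀ x → InCone ℓ x → 0ℤ ≤ y · x

OnRay : ∀ {d} → Vecℤ d → Vecℤ d → Set
OnRay {d} y a = Σ ℕ λ p → Σ ℕ λ q → (0ℤ < + q) × (∀ i → + q * a i ≡ + p * y i)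

ExtremeRayOfDual : ∀ {d m} → (Fin m → Vecℤ d) → Vecℤ d → Set
ExtremeRayOfDual ℓ y =
    InDual ℓ y
  × ¬ (∀ i → y i ≡ 0ℤ)
  × (∀ a b (N : ℕ) → 0ℤ < + N → InDual ℓ a → InDual ℓ b
       → (∀ i → a i + b i ≡ + N * y i) → OnRay y a × OnRay y b)

Primitive : ∀ {d} → Vecℤ d → Set
Primitive y = ∀ (k : ℕ) → (∀ i → + k ∣ y i) → k ≡ 1

AreSupportForms : ∀ {d m s} → (Fin m → Vecℤ d) → (Fin s → Vecℤ d) → Set
AreSupportForms {s = s} ℓ σ =
    (∀ j → Primitive (σ j) × ExtremeRayOfDual ℓ (σ j))
  × (∀ j j' → (∀ i → σ j i ≡ σ j' i) → j ≡ j')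
  × (∀ y → Primitive y → ExtremeRayOfDual ℓ y → ∃ λ j → ∀ i → σ j i ≡ y i)

Generates : ∀ {d m n} → (Fin m → Vecℤ d) → (Fin n → Vecℤ d) → Subset n → Set
Generates {n = n} ℓ x S =
  ∀ v → InCone ℓ v →
    Σ (Fin n → ℕ) λ c → (∀ i → i ∉ S → c i ≡ 0)
                      × (∀ t → v t ≡ ∑ (λ i → + c i * x i t))

IsHilbertBasis : ∀ {d m n} → (Fin m → Vecℤ d) → (Fin n → Vecℤ d) → Set
IsHilbertBasis {n = n} ℓ x =
    (∀ i → InCone ℓ (x i))
  × (∀ i i' → (∀ t → x i t ≡ x i' t) → i ≡ i')
  × (∀ S → Generates ℓ x S → ∀ i → i ∈ S)
  × (∀ S → (∀ i → i ∈ S) → Generates ℓ x S)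

IsAut : ∀ {d m} → (Fin m → Vecℤ d) → Matℤ d → Set
IsAut {d} ℓ A =
    (Σ (Matℤ d) λ B → IsInverse A B)
  × (∀ v → InCone ℓ v → InCone ℓ (A *v v))
  × (∀ w → InCone ℓ w → Σ (Vecℤ d) λ v → InCone ℓ v × (∀ t → (A *v v) t ≡ w t))

Induces : ∀ {d n} → (Fin n → Vecℤ d) → Matℤ d → Permutation′ n → Set
Induces x A Π = ∀ i t → (A *v x i) t ≡ x (Π ⟨$⟩ʳ i) t

Admissible : ∀ {d n s} → (Fin n → Vecℤ d) → (Fin s → Vecℤ d) → Permutation′ n → Set
Admissible {s = s} x σ Π =
  Σ (Permutation′ s) λ Σp → ∀ i j → σ (Σp ⟨$⟩ʳ j) · x (Π ⟨$⟩ʳ i) ≡ σ j · x i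

{-# OPTIONS --safe #-}
-- An automorphism of C permutes the irreducible lattice points of C and, by
-- duality, the primitive extreme rays of C*; it is determined by the former
-- because they span.
--
-- Conversely, the Hilbert basis generates ℤ^d as a group (move δ t into C by
-- adding a large multiple of Σ xᵢ), so an admissible Π extends to an integral
-- matrix as soon as it preserves the linear relations among the xᵢ.  It does,
-- because the support forms separate points.  For the latter let all σⱼ vanish
-- at v.  Then every y in C* = { y | y · xᵢ ≥ 0 for all i } vanishes at v, by
-- induction on the number of i with y · xᵢ ≠ 0: if a lies in the smallest face
-- containing y, then y and a can be pushed along each other into proper
-- faces, q y - p a and q' a - p' y, where the induction hypothesis applies.  If
-- y · v ≠ 0, this forces q q' = p p' and then q' a = p' y, so y spans an extreme
-- ray and its primitive multiple is some σⱼ, a contradiction.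

module Submission where

open import Defs
open import Data.Bool using (if_then_else_)
open import Data.Fin using (Fin; zero; suc)
open import Data.Fin.Permutation using (Permutation′; _⟨$⟩ʳ_; _⟨$⟩ˡ_; permutation; flip; inverseʳ)
import Data.Fin.Properties as Fin
open import Data.Fin.Subset using (⊤; ∁; ⁅_⁆)
open import Data.Fin.Subset.Properties using (∈⊤; x∈∁p⇒x∉p; x∉∁p⇒x∈p; x∈⁅x⁆; x∈⁅y⁆⇒x≡y)
open import Data.Integer using (ℤ; +_; -[1+_]; _+_; _*_; -_; _-_; _≤_; _<_; 0ℤ; 1ℤ; ∣_∣; +≤+; -≤+; +<+; _≟_; _≤?_; nonNegative; positive; ≢-nonZero)
open import Data.Integer.Divisibility.Signed using (_∣_; divides; ∣⇒∣ᵤ; ∣ᵤ⇒∣; ∣m⇒∣m*n; ∣m∣n⇒∣m+n)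
open import Data.Integer.Properties hiding (_≟_; _≤?_)
open import Data.Integer.Tactic.RingSolver using (solve-∀)
open import Data.Nat as ℕ using (ℕ; zero; suc)
import Data.Nat.Divisibility as ℕ
open import Data.Nat.GCD using (gcd; gcd[m,n]∣m; gcd[m,n]∣n; gcd-greatest)
open import Data.Nat.Induction using (<-wellFounded)
import Data.Nat.Properties as ℕ
open import Data.Product using (Σ; _×_; _,_; proj₁; proj₂; ∃)
open import Data.Sum using (_⊎_; inj₁; inj₂)
open import Induction.WellFounded using (Acc; acc)
open import Relation.Binary.PropositionalEquality using (_≡_; _≢_; _≗_; refl; sym; trans; cong; cong₂; subst; module ≡-Reasoning)
open import Relation.Nullary using (¬_; yes; no; does; contradiction)
open import Relation.Nullary.Decidable using (¬?; decidable-stable)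
import Algebra.Properties.Semiring.Sum +-*-semiring as Sum

-- Finite sums, inequalities over ℤ and the Kronecker delta.

∑≡sum : ∀ {n} (f : Fin n → ℤ) → ∑ f ≡ Sum.sum f
∑≡sum {zero}  f = refl
∑≡sum {suc n} f = cong (_+_ (f zero)) (∑≡sum (λ i → f (suc i)))

∑-cong : ∀ {n} {f g : Fin n → ℤ} → f ≗ g → ∑ f ≡ ∑ g
∑-cong {zero}  f≗g = refl
∑-cong {suc n} f≗g = cong₂ _+_ (f≗g zero) (∑-cong (λ i → f≗g (suc i)))

∑-zero : ∀ {n} {f : Fin n → ℤ} → (∀ i → f i ≡ 0ℤ) → ∑ f ≡ 0ℤ
∑-zero {zero}  f≡0 = refl
∑-zero {suc n} f≡0 = cong₂ _+_ (f≡0 zero) (∑-zero (λ i → f≡0 (suc i)))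

∑-distrib-+ : ∀ {n} (f g : Fin n → ℤ) → ∑ (λ i → f i + g i) ≡ ∑ f + ∑ g
∑-distrib-+ f g = trans (∑≡sum (λ i → f i + g i))
  (trans (Sum.∑-distrib-+ f g) (sym (cong₂ _+_ (∑≡sum f) (∑≡sum g))))

*-distribˡ-∑ : ∀ {n} k (f : Fin n → ℤ) → k * ∑ f ≡ ∑ (λ i → k * f i)
*-distribˡ-∑ k f = trans (cong (k *_) (∑≡sum f))
  (trans (Sum.*-distribˡ-sum k f) (sym (∑≡sum (λ i → k * f i))))

∑-comm : ∀ {m n} (f : Fin m → Fin n → ℤ) → ∑ (λ i → ∑ (f i)) ≡ ∑ (λ j → ∑ (λ i → f i j))
∑-comm f = begin
  ∑ (λ i → ∑ (f i))                      ≡⟨ ∑-cong (λ i → ∑≡sum (f i)) ⟩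
  ∑ (λ i → Sum.sum (f i))                ≡⟨ ∑≡sum (λ i → Sum.sum (f i)) ⟩
  Sum.sum (λ i → Sum.sum (f i))          ≡⟨ Sum.∑-comm f ⟩
  Sum.sum (λ j → Sum.sum (λ i → f i j))  ≡⟨ ∑≡sum (λ j → Sum.sum (λ i → f i j)) ⟨
  ∑ (λ j → Sum.sum (λ i → f i j))        ≡⟨ ∑-cong (λ j → ∑≡sum (λ i → f i j)) ⟨
  ∑ (λ j → ∑ (λ i → f i j))              ∎
  where open ≡-Reasoning

∑-nonNeg : ∀ {n} {f : Fin n → ℤ} → (∀ i → 0ℤ ≤ f i) → 0ℤ ≤ ∑ f
∑-nonNeg {zero}  f≥0 = ≤-refl
∑-nonNeg {suc n} f≥0 = +-mono-≤ (f≥0 zero) (∑-nonNeg (λ i → f≥0 (suc i)))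

term≤∑ : ∀ {n} {f : Fin n → ℤ} → (∀ i → 0ℤ ≤ f i) → ∀ k → f k ≤ ∑ f
term≤∑ {f = f} f≥0 zero    = subst (_≤ ∑ f) (+-identityʳ _)
  (+-monoʳ-≤ (f zero) (∑-nonNeg (λ i → f≥0 (suc i))))
term≤∑ {f = f} f≥0 (suc k) = subst (_≤ ∑ f) (+-identityˡ _)
  (+-mono-≤ (f≥0 zero) (term≤∑ (λ i → f≥0 (suc i)) k))

*-nonNeg : ∀ {i j} → 0ℤ ≤ i → 0ℤ ≤ j → 0ℤ ≤ i * j
*-nonNeg {i} {j} 0≤i 0≤j = subst (_≤ i * j) (*-zeroʳ i) (*-monoˡ-≤-nonNeg i {{nonNegative 0≤i}} 0≤j)

+-nonNeg-zeroʳ : ∀ {i j} → 0ℤ ≤ i → 0ℤ ≤ j → i + j ≡ 0ℤ → j ≡ 0ℤ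
+-nonNeg-zeroʳ {i} {j} 0≤i 0≤j i+j≡0 =
  ≤-antisym (subst (j ≤_) i+j≡0 (subst (_≤ i + j) (+-identityˡ j) (+-monoˡ-≤ j 0≤i))) 0≤j

δ-diag : ∀ {n} (i : Fin n) → δ i i ≡ 1ℤ
δ-diag zero    = refl
δ-diag (suc i) = δ-diag i

δ-off : ∀ {n} {i j : Fin n} → i ≢ j → δ i j ≡ 0ℤ
δ-off {i = zero}  {zero}  i≢j = contradiction refl i≢j
δ-off {i = zero}  {suc j} i≢j = refl
δ-off {i = suc i} {zero}  i≢j = refl
δ-off {i = suc i} {suc j} i≢j = δ-off (λ i≡j → i≢j (cong suc i≡j))

δ-sym : ∀ {n} (i j : Fin n) → δ i j ≡ δ j i
δ-sym zero    zero    = refl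
δ-sym zero    (suc j) = refl
δ-sym (suc i) zero    = refl
δ-sym (suc i) (suc j) = δ-sym i j

-- Dot products, linear combinations and matrix actions.

·-congˡ : ∀ {d} {y y' : Vecℤ d} (v : Vecℤ d) → y ≗ y' → y · v ≡ y' · v
·-congˡ v y≗y' = ∑-cong (λ i → cong (_* v i) (y≗y' i))

·-congʳ : ∀ {d} (y : Vecℤ d) {v v' : Vecℤ d} → v ≗ v' → y · v ≡ y · v'
·-congʳ y v≗v' = ∑-cong (λ i → cong (y i *_) (v≗v' i))

·-zeroˡ : ∀ {d} {y : Vecℤ d} (v : Vecℤ d) → (∀ i → y i ≡ 0ℤ) → y · v ≡ 0ℤ
·-zeroˡ v y≡0 = ∑-zero (λ i → trans (cong (_* v i) (y≡0 i)) (*-zeroˡ (v i)))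

·-zeroʳ : ∀ {d} (y : Vecℤ d) {v : Vecℤ d} → (∀ i → v i ≡ 0ℤ) → y · v ≡ 0ℤ
·-zeroʳ y v≡0 = ∑-zero (λ i → trans (cong (y i *_) (v≡0 i)) (*-zeroʳ (y i)))

·-comm : ∀ {d} (y v : Vecℤ d) → y · v ≡ v · y
·-comm y v = ∑-cong (λ i → *-comm (y i) (v i))

·-distribʳ-+ : ∀ {d} (a b v : Vecℤ d) → (λ i → a i + b i) · v ≡ a · v + b · v
·-distribʳ-+ a b v = trans (∑-cong (λ i → *-distribʳ-+ (v i) (a i) (b i)))
  (∑-distrib-+ (λ i → a i * v i) (λ i → b i * v i))

·-scaleˡ : ∀ {d} k (a v : Vecℤ d) → (λ i → k * a i) · v ≡ k * (a · v)
·-scaleˡ k a v = trans (∑-cong (λ i → *-assoc k (a i) (v i))) (sym (*-distribˡ-∑ k (λ i → a i * v i)))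

·-distribʳ-- : ∀ {d} (a b v : Vecℤ d) → (λ i → a i - b i) · v ≡ a · v - b · v
·-distribʳ-- a b v = begin
  (λ i → a i - b i) · v             ≡⟨ ·-distribʳ-+ a (λ i → - b i) v ⟩
  a · v + (λ i → - b i) · v         ≡⟨ cong (_+_ (a · v)) (·-congˡ v (λ i → sym (-1*i≡-i (b i)))) ⟩
  a · v + (λ i → - 1ℤ * b i) · v    ≡⟨ cong (_+_ (a · v)) (·-scaleˡ (- 1ℤ) b v) ⟩
  a · v + - 1ℤ * (b · v)            ≡⟨ cong (_+_ (a · v)) (-1*i≡-i (b · v)) ⟩
  a · v - b · v                     ∎
  where open ≡-Reasoning

·-neg : ∀ {d} (y v : Vecℤ d) → y · (λ i → - v i) ≡ - (y · v)
·-neg y v = begin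
  y · (λ i → - v i)        ≡⟨ ·-comm y _ ⟩
  (λ i → - v i) · y        ≡⟨ ·-congˡ y (λ i → sym (-1*i≡-i (v i))) ⟩
  (λ i → - 1ℤ * v i) · y   ≡⟨ ·-scaleˡ (- 1ℤ) v y ⟩
  - 1ℤ * (v · y)           ≡⟨ -1*i≡-i (v · y) ⟩
  - (v · y)                ≡⟨ cong -_ (·-comm v y) ⟩
  - (y · v)                ∎
  where open ≡-Reasoning

δ-· : ∀ {d} (i : Fin d) (v : Vecℤ d) → δ i · v ≡ v i
δ-· {suc d} zero    v = trans (cong₂ _+_ (*-identityˡ (v zero)) (∑-zero (λ i → *-zeroˡ (v (suc i))))) (+-identityʳ (v zero))
δ-· {suc d} (suc i) v = trans (cong₂ _+_ (*-zeroˡ (v zero)) (δ-· i (λ j → v (suc j)))) (+-identityˡ (v (suc i)))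

·-δ : ∀ {d} (y : Vecℤ d) (k : Fin d) → y · (λ i → δ i k) ≡ y k
·-δ y k = trans (·-comm y _) (trans (·-congˡ y (λ i → δ-sym i k)) (δ-· k y))

infixl 8 _⊙_

-- A matrix is read as its family of rows: `y ⊙ A` is the row vector yA, that is, the form y
-- composed with A, and `A i ⊙ B` is row i of the product AB.
_⊙_ : ∀ {n d} → (Fin n → ℤ) → (Fin n → Vecℤ d) → Vecℤ d
(c ⊙ x) t = c · (λ i → x i t)

-- Interchange of two sums. For a matrix in place of `x` it is the adjunction between `y ⊙ A` and
-- `A *v v`; with a column for `v` it is associativity of matrix products.
⊙-· : ∀ {n d} (c : Fin n → ℤ) (x : Fin n → Vecℤ d) v → (c ⊙ x) · v ≡ c · (λ i → x i · v)
⊙-· c x v = begin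
  ∑ (λ t → ∑ (λ i → c i * x i t) * v t)     ≡⟨ ∑-cong (λ t → trans (*-comm _ (v t)) (*-distribˡ-∑ (v t) (λ i → c i * x i t))) ⟩
  ∑ (λ t → ∑ (λ i → v t * (c i * x i t)))   ≡⟨ ∑-comm (λ t i → v t * (c i * x i t)) ⟩
  ∑ (λ i → ∑ (λ t → v t * (c i * x i t)))   ≡⟨ ∑-cong (λ i → ∑-cong (λ t → rearrange (v t) (c i) (x i t))) ⟩
  ∑ (λ i → ∑ (λ t → c i * (x i t * v t)))   ≡⟨ ∑-cong (λ i → *-distribˡ-∑ (c i) (λ t → x i t * v t)) ⟨
  ∑ (λ i → c i * ∑ (λ t → x i t * v t))     ∎
  where
  open ≡-Reasoning
  rearrange : ∀ a b e → a * (b * e) ≡ b * (e * a)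
  rearrange = solve-∀

·-⊙ : ∀ {n d} (y : Vecℤ d) (c : Fin n → ℤ) (x : Fin n → Vecℤ d) → y · (c ⊙ x) ≡ c · (λ i → y · x i)
·-⊙ y c x = trans (·-comm y _) (trans (⊙-· c x y) (·-congʳ c (λ i → ·-comm (x i) y)))

*v-inverse : ∀ {d} {A B : Matℤ d} → (∀ i k → (A i ⊙ B) k ≡ δ i k) → ∀ v → A *v (B *v v) ≗ v
*v-inverse {A = A} {B} AB≡1 v i =
  trans (sym (⊙-· (A i) B v)) (trans (·-congˡ v (AB≡1 i)) (δ-· i v))

⊙-inverse : ∀ {d} {A B : Matℤ d} → (∀ i k → (A i ⊙ B) k ≡ δ i k) → ∀ y → (y ⊙ A) ⊙ B ≗ y
⊙-inverse {A = A} {B} AB≡1 y t =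
  trans (⊙-· y A (λ i → B i t)) (trans (·-congʳ y (λ i → AB≡1 i t)) (·-δ y t))

-- Lattice points of the cone.

InCone-cong : ∀ {d m} (ℓ : Fin m → Vecℤ d) {v w : Vecℤ d} → v ≗ w → InCone ℓ v → InCone ℓ w
InCone-cong ℓ v≗w v∈C k = subst (0ℤ ≤_) (·-congʳ (ℓ k) v≗w) (v∈C k)

·-nonNeg : ∀ {n} {c v : Vecℤ n} → (∀ i → 0ℤ ≤ c i) → (∀ i → 0ℤ ≤ v i) → 0ℤ ≤ c · v
·-nonNeg c≥0 v≥0 = ∑-nonNeg (λ i → *-nonNeg (c≥0 i) (v≥0 i))

InCone-⊙ : ∀ {d m n} (ℓ : Fin m → Vecℤ d) {c : Fin n → ℤ} {w : Fin n → Vecℤ d} →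
           (∀ i → 0ℤ ≤ c i) → (∀ i → InCone ℓ (w i)) → InCone ℓ (c ⊙ w)
InCone-⊙ ℓ {c} {w} c≥0 w∈C k =
  subst (0ℤ ≤_) (sym (·-⊙ (ℓ k) c w)) (·-nonNeg c≥0 (λ i → w∈C i k))

-- Pointedness makes the relation "the difference lies in C" antisymmetric: `v - w` and its negative
-- both lie in C.
cone-antisym : ∀ {d m} (ℓ : Fin m → Vecℤ d) → Pointed ℓ → ∀ {v w} →
               InCone ℓ (λ i → v i - w i) → InCone ℓ (λ i → w i - v i) → v ≗ w
cone-antisym ℓ pointed {v} {w} v-w∈C w-v∈C i = i-j≡0⇒i≡j (v i) (w i)
  (pointed (λ i → v i - w i) v-w∈C (InCone-cong ℓ (λ i → flip-- (w i) (v i)) w-v∈C) i)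
  where
  flip-- : ∀ a b → a - b ≡ - (b - a)
  flip-- = solve-∀

-- By integrality a nonzero coefficient `c k` is at least 1, so one copy of the k-th vector can be
-- taken off a combination without leaving the cone.
∸δ-nonNeg : ∀ {n} {c : Fin n → ℤ} {k} → (∀ i → 0ℤ ≤ c i) → c k ≢ 0ℤ → ∀ i → 0ℤ ≤ c i - δ k i
∸δ-nonNeg {c = c} {k} c≥0 ck≢0 i with k Fin.≟ i
... | yes refl rewrite δ-diag k = i≤j⇒0≤j-i (i<j⇒suc[i]≤j (≤∧≢⇒< (c≥0 k) (λ 0≡ck → ck≢0 (sym 0≡ck))))
... | no k≢i rewrite δ-off k≢i = subst (0ℤ ≤_) (sym (+-identityʳ (c i))) (c≥0 i)

-- Surjectivity of A on C turns into invariance under B: if v = Au with u in C, then Bv = u.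
IsAut-inverse : ∀ {d m} (ℓ : Fin m → Vecℤ d) {A : Matℤ d} (((B , _) , _) : IsAut ℓ A) → IsAut ℓ B
IsAut-inverse ℓ {A = A} ((B , AB , BA) , A-into , A-onto) =
  (A , BA , AB) ,
  (λ v v∈C → let u , u∈C , Au≗v = A-onto v v∈C in
     InCone-cong ℓ (λ t → trans (sym (*v-inverse {A = B} {A} BA u t)) (·-congʳ (B t) Au≗v)) u∈C) ,
  (λ w w∈C → A *v w , A-into w w∈C , *v-inverse {A = B} {A} BA w)

-- The Hilbert basis: spanning, irreducibility, permutation by automorphisms.

module HilbertBasis {d m n} {ℓ : Fin m → Vecℤ d} {x : Fin n → Vecℤ d}
  (fullDim : FullDim ℓ) (pointed : Pointed ℓ) (hilbert : IsHilbertBasis ℓ x) where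

  x∈C : ∀ i → InCone ℓ (x i)
  x∈C = proj₁ hilbert

  x-injective : ∀ {i i'} → x i ≗ x i' → i ≡ i'
  x-injective = proj₁ (proj₂ hilbert) _ _

  generates : ∀ {v} → InCone ℓ v → ∃ λ (c : Fin n → ℤ) → (∀ i → 0ℤ ≤ c i) × v ≗ c ⊙ x
  generates {v} v∈C =
    let c , _ , v≗c⊙x = proj₂ (proj₂ (proj₂ hilbert)) ⊤ (λ _ → ∈⊤) v v∈C
    in (λ i → + c i) , (λ i → +≤+ ℕ.z≤n) , v≗c⊙x

  -- Cone points are nonnegative combinations of the basis, so finitely many inequalities cut out
  -- C*. This makes a ratio test over the indices of `x` possible.
  nonNeg-on-x⇒InDual : ∀ {y} → (∀ i → 0ℤ ≤ y · x i) → InDual ℓ y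
  nonNeg-on-x⇒InDual {y} y≥0 v v∈C =
    let c , c≥0 , v≗c⊙x = generates v∈C
    in subst (0ℤ ≤_) (sym (trans (·-congʳ y v≗c⊙x) (·-⊙ y c x))) (·-nonNeg c≥0 y≥0)

  zero-on-x⇒zero : ∀ {y} → (∀ i → y · x i ≡ 0ℤ) → ∀ t → y t ≡ 0ℤ
  zero-on-x⇒zero {y} y≡0 = fullDim y λ v v∈C →
    let c , _ , v≗c⊙x = generates v∈C
    in trans (·-congʳ y v≗c⊙x) (trans (·-⊙ y c x) (·-zeroʳ c y≡0))

  equal-on-x⇒equal : ∀ {y y'} → (∀ i → y · x i ≡ y' · x i) → y ≗ y'
  equal-on-x⇒equal {y} {y'} y≡y' t = i-j≡0⇒i≡j (y t) (y' t)
    (zero-on-x⇒zero {λ t → y t - y' t}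
      (λ i → trans (·-distribʳ-- y y' (x i)) (i≡j⇒i-j≡0 (y≡y' i))) t)

  -- If c i vanished, x i could be eliminated from every representation,
  -- so the other basis elements would already generate.
  self-coefficient≢0 : ∀ {i} {c : Fin n → ℤ} → (∀ k → 0ℤ ≤ c k) → x i ≗ c ⊙ x → c i ≢ 0ℤ
  self-coefficient≢0 {i} {c} c≥0 xi≗c⊙x ci≡0 =
    x∈∁p⇒x∉p (proj₁ (proj₂ (proj₂ hilbert)) (∁ ⁅ i ⁆) others-generate i) (x∈⁅x⁆ i)
    where
    module _ (e : Fin n → ℤ) (e≥0 : ∀ k → 0ℤ ≤ e k) where
      -- All `e i` copies of `x i` are traded for as many copies of its expansion `c ⊙ x`, which
      -- does not involve `x i`.
      e′ : Fin n → ℤ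
      e′ k = e k + e i * (c k - δ i k)

      e′i≡0 : e′ i ≡ 0ℤ
      e′i≡0 rewrite ci≡0 | δ-diag i = cancel (e i)
        where
        cancel : ∀ a → a + a * (0ℤ - 1ℤ) ≡ 0ℤ
        cancel = solve-∀

      e′≥0 : ∀ k → 0ℤ ≤ e′ k
      e′≥0 k with i Fin.≟ k
      ... | yes refl = ≤-reflexive (sym e′i≡0)
      ... | no i≢k rewrite δ-off i≢k | +-identityʳ (c k) = +-mono-≤ (e≥0 k) (*-nonNeg (e≥0 i) (c≥0 k))

      e′⊙x : e′ ⊙ x ≗ e ⊙ x
      e′⊙x t = begin
        (e′ ⊙ x) t                                       ≡⟨ ·-distribʳ-+ e (λ k → e i * (c k - δ i k)) xₜ ⟩
        (e ⊙ x) t + (λ k → e i * (c k - δ i k)) · xₜ     ≡⟨ cong (_+_ ((e ⊙ x) t)) (·-scaleˡ (e i) (λ k → c k - δ i k) xₜ) ⟩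
        (e ⊙ x) t + e i * ((λ k → c k - δ i k) · xₜ)     ≡⟨ cong (λ z → (e ⊙ x) t + e i * z) relation ⟩
        (e ⊙ x) t + e i * 0ℤ                             ≡⟨ cong (_+_ ((e ⊙ x) t)) (*-zeroʳ (e i)) ⟩
        (e ⊙ x) t + 0ℤ                                   ≡⟨ +-identityʳ _ ⟩
        (e ⊙ x) t                                        ∎
        where
        open ≡-Reasoning
        xₜ : Fin n → ℤ
        xₜ k = x k t
        relation : (λ k → c k - δ i k) · xₜ ≡ 0ℤ
        relation = trans (·-distribʳ-- c (δ i) xₜ)
          (i≡j⇒i-j≡0 (trans (sym (xi≗c⊙x t)) (sym (δ-· i xₜ))))

    others-generate : Generates ℓ x (∁ ⁅ i ⁆)
    others-generate v v∈C =
      let e , e≥0 , v≗e⊙x = generates v∈C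
      in (λ k → ∣ e′ e e≥0 k ∣) ,
         (λ k k∉ → cong ∣_∣ (subst (λ j → e′ e e≥0 j ≡ 0ℤ) (sym (x∈⁅y⁆⇒x≡y i (x∉∁p⇒x∈p k∉))) (e′i≡0 e e≥0))) ,
         (λ t → trans (v≗e⊙x t) (trans (sym (e′⊙x e e≥0 t))
           (sym (·-congˡ (λ k → x k t) (λ k → 0≤i⇒+∣i∣≡i (e′≥0 e e≥0 k))))))

  -- Expanding each w k in the basis, some w k with c k ≥ 1 involves x i;
  -- then w k - x i and x i - w k both lie in the cone.
  x-irreducible : ∀ {i} {p} {c : Fin p → ℤ} {w : Fin p → Vecℤ d} → (∀ k → 0ℤ ≤ c k) →
                  (∀ k → InCone ℓ (w k)) → x i ≗ c ⊙ w → ∃ λ k → x i ≗ w k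
  x-irreducible {i} {p} {c} {w} c≥0 w∈C xi≗c⊙w
    with Fin.any? (λ k → ¬? (c k * proj₁ (generates (w∈C k)) i ≟ 0ℤ))
  ... | yes (k , ce≢0) = k , cone-antisym ℓ pointed {x i} {w k}
          (InCone-cong ℓ (λ t → trans (·-distribʳ-- c (δ k) (λ l → w l t))
                                    (cong₂ _-_ (sym (xi≗c⊙w t)) (δ-· k (λ l → w l t))))
            (InCone-⊙ ℓ {w = w} (∸δ-nonNeg {c = c} c≥0 ck≢0) w∈C))
          (InCone-cong ℓ (λ t → trans (·-distribʳ-- (e k) (δ i) (λ l → x l t))
                                    (cong₂ _-_ (sym (w≗e⊙x k t)) (δ-· i (λ l → x l t))))
            (InCone-⊙ ℓ {w = x} (∸δ-nonNeg {c = e k} (e≥0 k) eki≢0) x∈C))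
    where
    e : Fin p → Fin n → ℤ
    e k = proj₁ (generates (w∈C k))
    e≥0 : ∀ k l → 0ℤ ≤ e k l
    e≥0 k = proj₁ (proj₂ (generates (w∈C k)))
    w≗e⊙x : ∀ k → w k ≗ e k ⊙ x
    w≗e⊙x k = proj₂ (proj₂ (generates (w∈C k)))
    ck≢0 : c k ≢ 0ℤ
    ck≢0 ck≡0 = ce≢0 (trans (cong (_* e k i) ck≡0) (*-zeroˡ (e k i)))
    eki≢0 : e k i ≢ 0ℤ
    eki≢0 eki≡0 = ce≢0 (trans (cong (c k *_) eki≡0) (*-zeroʳ (c k)))
  -- Otherwise the expansion `c ⊙ e` of `x i`, obtained by inserting those of the `w k`, has i-th
  -- coefficient 0.
  ... | no none = contradiction
          (∑-zero (λ k → decidable-stable (_ ≟ 0ℤ) (λ ce≢0 → none (k , ce≢0))))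
          (self-coefficient≢0 {c = c ⊙ e} (λ l → ·-nonNeg c≥0 (λ k → proj₁ (proj₂ (generates (w∈C k))) l))
            (λ t → trans (xi≗c⊙w t)
              (trans (·-congʳ c (λ k → proj₂ (proj₂ (generates (w∈C k))) t))
                     (sym (⊙-· c e (λ l → x l t))))))
    where
    e : Fin p → Fin n → ℤ
    e k = proj₁ (generates (w∈C k))

  -- Applying B to an expansion of `A *v x i` writes `x i` as a combination of the cone points
  -- `B *v x k`. Irreducibility makes `x i` equal to one of them, and A carries this back.
  aut-image-of-x : ∀ {A} → IsAut ℓ A → ∀ i → ∃ λ k → A *v x i ≗ x k
  aut-image-of-x {A} aut@((B , AB , BA) , A-into , _) i =
    let c , c≥0 , Axi≗c⊙x = generates (A-into (x i) (x∈C i))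
        k , xi≗Bxk = x-irreducible {w = λ k → B *v x k} c≥0
          (λ k → proj₁ (proj₂ (IsAut-inverse ℓ {A} aut)) (x k) (x∈C k))
          (λ t → trans (sym (*v-inverse {A = B} {A} BA (x i) t))
            (trans (·-congʳ (B t) Axi≗c⊙x) (·-⊙ (B t) c x)))
    in k , λ t → trans (·-congʳ (A t) xi≗Bxk) (*v-inverse {A = A} {B} AB (x k) t)

  x-indices-inverse : ∀ {A B : Matℤ d} {f g : Fin n → Fin n} → (∀ i k → (A i ⊙ B) k ≡ δ i k) →
                      (∀ i → A *v x i ≗ x (f i)) → (∀ i → B *v x i ≗ x (g i)) → ∀ i → f (g i) ≡ i
  x-indices-inverse {A} {B} {f} {g} AB Ax≗xf Bx≗xg i = x-injective λ t →
    trans (sym (Ax≗xf (g i) t))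
      (trans (·-congʳ (A t) (λ s → sym (Bx≗xg i s))) (*v-inverse {A = A} {B} AB (x i) t))

  aut-permutes-x : ∀ A → IsAut ℓ A → Σ (Permutation′ n) (Induces x A)
  aut-permutes-x A aut@((B , AB , BA) , _) =
    permutation (λ i → proj₁ (image i)) (λ i → proj₁ (image⁻¹ i))
      (x-indices-inverse {A} {B} AB (λ i → proj₂ (image i)) (λ i → proj₂ (image⁻¹ i)))
      (x-indices-inverse {B} {A} BA (λ i → proj₂ (image⁻¹ i)) (λ i → proj₂ (image i))) ,
    λ i → proj₂ (image i)
    where
    image : ∀ i → ∃ λ k → A *v x i ≗ x k
    image = aut-image-of-x {A} aut
    image⁻¹ : ∀ i → ∃ λ k → B *v x i ≗ x k
    image⁻¹ = aut-image-of-x {B} (IsAut-inverse ℓ {A} aut)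

  -- Each row of A is a form whose values on the spanning set `x` are prescribed by Π.
  Induces-injective : ∀ {A A' Π} → Induces x A Π → Induces x A' Π → ∀ i j → A i j ≡ A' i j
  Induces-injective A-ind A'-ind t = equal-on-x⇒equal (λ i → trans (A-ind i t) (sym (A'-ind i t)))

-- Composition of dual forms with automorphisms.

InDual-⊙ : ∀ {d m} (ℓ : Fin m → Vecℤ d) (A : Matℤ d) → (∀ v → InCone ℓ v → InCone ℓ (A *v v)) →
           ∀ {y} → InDual ℓ y → InDual ℓ (y ⊙ A)
InDual-⊙ ℓ A A-into {y} y∈D v v∈C = subst (0ℤ ≤_) (sym (⊙-· y A v)) (y∈D (A *v v) (A-into v v∈C))

OnRay-⊙ : ∀ {d} (A : Matℤ d) {y a : Vecℤ d} → OnRay y a → OnRay (y ⊙ A) (a ⊙ A)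
OnRay-⊙ A {y} {a} (p , q , q>0 , qa≗py) = p , q , q>0 , λ t →
  trans (sym (·-scaleˡ (+ q) a (λ i → A i t)))
    (trans (·-congˡ (λ i → A i t) qa≗py) (·-scaleˡ (+ p) y (λ i → A i t)))

OnRay-congʳ : ∀ {d} {y a a' : Vecℤ d} → a ≗ a' → OnRay y a → OnRay y a'
OnRay-congʳ a≗a' (p , q , q>0 , qa≗py) = p , q , q>0 , λ t → trans (cong (+ q *_) (sym (a≗a' t))) (qa≗py t)

-- A decomposition of a multiple of yB becomes, after composition with A, one of a multiple of y.
-- Its summands lie on the ray of y, and composing with B returns them to the ray of yB.
ExtremeRay-⊙ : ∀ {d m} (ℓ : Fin m → Vecℤ d) {A B : Matℤ d} → IsInverse A B →
               (∀ v → InCone ℓ v → InCone ℓ (A *v v)) → (∀ v → InCone ℓ v → InCone ℓ (B *v v)) →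
               ∀ {y} → ExtremeRayOfDual ℓ y → ExtremeRayOfDual ℓ (y ⊙ B)
ExtremeRay-⊙ ℓ {A} {B} (AB , BA) A-into B-into {y} (y∈D , y≢0 , y-extreme) =
  InDual-⊙ ℓ B B-into {y} y∈D ,
  (λ yB≡0 → y≢0 λ i → trans (sym (⊙-inverse {A = B} {A} BA y i)) (·-zeroˡ (λ k → A k i) yB≡0)) ,
  λ a b N N>0 a∈D b∈D a+b≗NyB →
    let aA-ray , bA-ray = y-extreme (a ⊙ A) (b ⊙ A) N N>0 (InDual-⊙ ℓ A A-into {a} a∈D) (InDual-⊙ ℓ A A-into {b} b∈D)
          (λ t → trans (sym (·-distribʳ-+ a b (λ i → A i t)))
            (trans (·-congˡ (λ i → A i t) a+b≗NyB)
              (trans (·-scaleˡ (+ N) (y ⊙ B) (λ i → A i t))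
                     (cong (+ N *_) (⊙-inverse {A = B} {A} BA y t)))))
    in OnRay-congʳ (⊙-inverse {A = A} {B} AB a) (OnRay-⊙ B aA-ray) ,
       OnRay-congʳ (⊙-inverse {A = A} {B} AB b) (OnRay-⊙ B bA-ray)

∣-∑ : ∀ {n} {k : ℤ} {f : Fin n → ℤ} → (∀ i → k ∣ f i) → k ∣ ∑ f
∣-∑ {zero}  k∣f = divides 0ℤ refl
∣-∑ {suc n} k∣f = ∣m∣n⇒∣m+n (k∣f zero) (∣-∑ (λ i → k∣f (suc i)))

-- A common divisor of the entries of yB divides the entries of (yB)A = y.
Primitive-⊙ : ∀ {d} {A B : Matℤ d} → IsInverse A B → ∀ y → Primitive y → Primitive (y ⊙ B)
Primitive-⊙ {A = A} {B} (_ , BA) y y-prim k k∣yB = y-prim k λ i →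
  ∣⇒∣ᵤ (subst (+ k ∣_) (⊙-inverse {A = B} {A} BA y i)
    (∣-∑ (λ j → ∣m⇒∣m*n (A j i) (∣ᵤ⇒∣ {+ k} {(y ⊙ B) j} (k∣yB j)))))

-- Automorphisms permute the support forms.

module SupportForms {d m s} {ℓ : Fin m → Vecℤ d} {σ : Fin s → Vecℤ d}
  (support : AreSupportForms ℓ σ) where

  -- Composition is with the inverse B because the form `σ j ⊙ B` takes at Av the value of `σ j` at
  -- v, as `Admissible` demands.
  aut-image-of-σ : ∀ {A} (((B , _) , _) : IsAut ℓ A) → ∀ j → ∃ λ k → σ k ≗ σ j ⊙ B
  aut-image-of-σ {A} aut@((B , inv) , A-into , _) j =
    let σj-prim , σj-extreme = proj₁ support j in
    proj₂ (proj₂ support) (σ j ⊙ B) (Primitive-⊙ {A = A} inv (σ j) σj-prim)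
      (ExtremeRay-⊙ ℓ {A} {B} inv A-into (proj₁ (proj₂ (IsAut-inverse ℓ {A} aut))) {σ j} σj-extreme)

  σ-indices-inverse : ∀ {A B : Matℤ d} {f g : Fin s → Fin s} → (∀ i k → (B i ⊙ A) k ≡ δ i k) →
                      (∀ j → σ (f j) ≗ σ j ⊙ A) → (∀ j → σ (g j) ≗ σ j ⊙ B) → ∀ j → f (g j) ≡ j
  σ-indices-inverse {A} {B} {f} {g} BA σf≗σA σg≗σB j = proj₁ (proj₂ support) (f (g j)) j λ t →
    trans (σf≗σA (g j) t)
      (trans (·-congˡ (λ i → A i t) (σg≗σB j)) (⊙-inverse {A = B} {A} BA (σ j) t))

  aut⇒admissible : ∀ {n} {x : Fin n → Vecℤ d} A Π → IsAut ℓ A → Induces x A Π → Admissible x σ Π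
  aut⇒admissible {x = x} A Π aut@((B , AB , BA) , _) induces =
    permutation (λ j → proj₁ (image j)) (λ j → proj₁ (image⁻¹ j))
      (σ-indices-inverse {B} {A} AB (λ j → proj₂ (image j)) (λ j → proj₂ (image⁻¹ j)))
      (σ-indices-inverse {A} {B} BA (λ j → proj₂ (image⁻¹ j)) (λ j → proj₂ (image j))) ,
    λ i j → begin
      σ (proj₁ (image j)) · x (Π ⟨$⟩ʳ i)   ≡⟨ ·-congʳ (σ (proj₁ (image j))) (induces i) ⟨
      σ (proj₁ (image j)) · (A *v x i)     ≡⟨ ·-congˡ (A *v x i) (proj₂ (image j)) ⟩
      (σ j ⊙ B) · (A *v x i)               ≡⟨ ⊙-· (σ j) B (A *v x i) ⟩
      σ j · (B *v (A *v x i))              ≡⟨ ·-congʳ (σ j) (*v-inverse {A = B} {A} BA (x i)) ⟩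
      σ j · x i                            ∎
    where
    open ≡-Reasoning
    image : ∀ j → ∃ λ k → σ k ≗ σ j ⊙ B
    image = aut-image-of-σ {A} aut
    image⁻¹ : ∀ j → ∃ λ k → σ k ≗ σ j ⊙ A
    image⁻¹ = aut-image-of-σ {B} (IsAut-inverse ℓ {A} aut)

-- Ratio test, counting of nonzero values, primitive parts.

-- The index i minimises f i / g i among the indices with g i nonzero. The comparison is
-- cross-multiplied to stay in ℤ; where g k = 0 it only says that f k * g i is nonnegative.
min-ratio : ∀ {n} (f g : Fin n → ℤ) → (∀ k → 0ℤ ≤ f k) → (∀ k → 0ℤ ≤ g k) →
            (∀ k → g k ≡ 0ℤ) ⊎ ∃ λ i → g i ≢ 0ℤ × (∀ k → f i * g k ≤ f k * g i)
min-ratio {zero}  f g f≥0 g≥0 = inj₁ λ ()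
min-ratio {suc n} f g f≥0 g≥0
  with g zero ≟ 0ℤ | min-ratio (λ k → f (suc k)) (λ k → g (suc k)) (λ k → f≥0 (suc k)) (λ k → g≥0 (suc k))
... | yes g₀≡0 | inj₁ g≡0 = inj₁ (Fin.∀-cons g₀≡0 g≡0)
... | no  g₀≢0 | inj₁ g≡0 = inj₂ (zero , g₀≢0 , Fin.∀-cons ≤-refl λ k →
      subst (_≤ f (suc k) * g zero) (sym (trans (cong (f zero *_) (g≡0 k)) (*-zeroʳ (f zero))))
        (*-nonNeg (f≥0 (suc k)) (g≥0 zero)))
... | yes g₀≡0 | inj₂ (i , gᵢ≢0 , least) = inj₂ (suc i , gᵢ≢0 , Fin.∀-cons
      (subst (_≤ f zero * g (suc i)) (sym (trans (cong (f (suc i) *_) g₀≡0) (*-zeroʳ (f (suc i)))))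
        (*-nonNeg (f≥0 zero) (g≥0 (suc i))))
      least)
... | no  g₀≢0 | inj₂ (i , gᵢ≢0 , least) with f zero * g (suc i) ≤? f (suc i) * g zero
...   | no  ≰ = inj₂ (suc i , gᵢ≢0 , Fin.∀-cons (<⇒≤ (≰⇒> ≰)) least)
-- Transitivity of f₀/g₀ ≤ fᵢ/gᵢ ≤ fₖ/gₖ, obtained by multiplying through by the positive gᵢ and
-- cancelling it.
...   | yes f₀gᵢ≤fᵢg₀ = inj₂ (zero , g₀≢0 , Fin.∀-cons ≤-refl λ k →
        *-cancelʳ-≤-pos (f zero * g (suc k)) (f (suc k) * g zero) (g (suc i))
          {{positive (≤∧≢⇒< (g≥0 (suc i)) (λ 0≡gᵢ → gᵢ≢0 (sym 0≡gᵢ)))}} (begin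
            f zero * g (suc k) * g (suc i)    ≡⟨ swap (f zero) (g (suc k)) (g (suc i)) ⟩
            f zero * g (suc i) * g (suc k)    ≤⟨ *-monoʳ-≤-nonNeg (g (suc k)) {{nonNegative (g≥0 (suc k))}} f₀gᵢ≤fᵢg₀ ⟩
            f (suc i) * g zero * g (suc k)    ≡⟨ swap (f (suc i)) (g zero) (g (suc k)) ⟩
            f (suc i) * g (suc k) * g zero    ≤⟨ *-monoʳ-≤-nonNeg (g zero) {{nonNegative (g≥0 zero)}} (least k) ⟩
            f (suc k) * g (suc i) * g zero    ≡⟨ swap (f (suc k)) (g (suc i)) (g zero) ⟩
            f (suc k) * g zero * g (suc i)    ∎))
  where
  open ≤-Reasoning
  swap : ∀ a b c → a * b * c ≡ a * c * b
  swap = solve-∀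

[_≢0] : ℤ → ℕ
[ i ≢0] = if does (i ≟ 0ℤ) then 0 else 1

[≢0]-mono : ∀ {i j} → (j ≡ 0ℤ → i ≡ 0ℤ) → [ i ≢0] ℕ.≤ [ j ≢0]
[≢0]-mono {i} {j} j≡0⇒i≡0 with i ≟ 0ℤ | j ≟ 0ℤ
... | yes _   | _       = ℕ.z≤n
... | no i≢0  | yes j≡0 = contradiction (j≡0⇒i≡0 j≡0) i≢0
... | no _    | no _    = ℕ.≤-refl

[≢0]-strict : ∀ {i j} → i ≡ 0ℤ → j ≢ 0ℤ → [ i ≢0] ℕ.< [ j ≢0]
[≢0]-strict {i} {j} i≡0 j≢0 with i ≟ 0ℤ | j ≟ 0ℤ
... | no i≢0 | _       = contradiction i≡0 i≢0
... | yes _  | yes j≡0 = contradiction j≡0 j≢0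
... | yes _  | no _    = ℕ.≤-refl

-- The measure for the induction over faces of C*: a form in a smaller face is nonzero at fewer
-- basis elements.
#support : ∀ {n} → (Fin n → ℤ) → ℕ
#support {zero}  f = 0
#support {suc n} f = [ f zero ≢0] ℕ.+ #support (λ i → f (suc i))

#support-mono : ∀ {n} {f g : Fin n → ℤ} → (∀ i → g i ≡ 0ℤ → f i ≡ 0ℤ) → #support f ℕ.≤ #support g
#support-mono {zero}  g≡0⇒f≡0 = ℕ.z≤n
#support-mono {suc n} g≡0⇒f≡0 = ℕ.+-mono-≤ ([≢0]-mono (g≡0⇒f≡0 zero)) (#support-mono (λ i → g≡0⇒f≡0 (suc i)))

#support-strict : ∀ {n} {f g : Fin n → ℤ} → (∀ i → g i ≡ 0ℤ → f i ≡ 0ℤ) →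
                  ∀ i → f i ≡ 0ℤ → g i ≢ 0ℤ → #support f ℕ.< #support g
#support-strict g≡0⇒f≡0 zero    fi≡0 gi≢0 =
  ℕ.+-mono-<-≤ ([≢0]-strict fi≡0 gi≢0) (#support-mono (λ i → g≡0⇒f≡0 (suc i)))
#support-strict g≡0⇒f≡0 (suc i) fi≡0 gi≢0 =
  ℕ.+-mono-≤-< ([≢0]-mono (g≡0⇒f≡0 zero)) (#support-strict (λ i → g≡0⇒f≡0 (suc i)) i fi≡0 gi≢0)

-- The gcd of the entries. The empty vector gets 0, the neutral element of gcd, so only the zero
-- vector has content 0.
content : ∀ {d} → Vecℤ d → ℕ
content {zero}  y = 0
content {suc d} y = gcd ∣ y zero ∣ (content (λ i → y (suc i)))

content-divides : ∀ {d} (y : Vecℤ d) i → content y ℕ.∣ ∣ y i ∣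
content-divides y zero    = gcd[m,n]∣m ∣ y zero ∣ (content (λ i → y (suc i)))
content-divides y (suc i) = ℕ.∣-trans (gcd[m,n]∣n ∣ y zero ∣ (content (λ i → y (suc i))))
  (content-divides (λ i → y (suc i)) i)

content-greatest : ∀ {d} (y : Vecℤ d) {k} → (∀ i → k ℕ.∣ ∣ y i ∣) → k ℕ.∣ content y
content-greatest {zero}  y k∣y = _ ℕ.∣0
content-greatest {suc d} y k∣y = gcd-greatest (k∣y zero) (content-greatest (λ i → y (suc i)) (λ i → k∣y (suc i)))

-- If k divides every entry of y₀, then gk divides every entry of y and hence the content g, which
-- leaves k = 1.
primitive-part : ∀ {d} (y : Vecℤ d) → ¬ (∀ i → y i ≡ 0ℤ) →
                 ∃ λ (g : ℕ) → ∃ λ (y₀ : Vecℤ d) → g ≢ 0 × (∀ i → y i ≡ + g * y₀ i) × Primitive y₀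
primitive-part {d} y y≢0 = g , y₀ , g≢0 , y≡gy₀ , y₀-primitive
  where
  g : ℕ
  g = content y
  g∣y : ∀ i → + g ∣ y i
  g∣y i = ∣ᵤ⇒∣ (content-divides y i)
  y₀ : Vecℤ d
  y₀ i = _∣_.quotient (g∣y i)
  y≡gy₀ : ∀ i → y i ≡ + g * y₀ i
  y≡gy₀ i = trans (_∣_.equality (g∣y i)) (*-comm (y₀ i) (+ g))
  g≢0 : g ≢ 0
  g≢0 g≡0 = y≢0 λ i → trans (y≡gy₀ i) (cong (λ k → + k * y₀ i) g≡0)
  y₀-primitive : Primitive y₀
  y₀-primitive k k∣y₀ = ℕ.∣1⇒≡1 (ℕ.*-cancelˡ-∣ g {{ℕ.≢-nonZero g≢0}}
    (subst (g ℕ.* k ℕ.∣_) (sym (ℕ.*-identityʳ g)) (content-greatest y λ i →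
      subst (g ℕ.* k ℕ.∣_) (sym (trans (cong ∣_∣ (y≡gy₀ i)) (abs-* (+ g) (y₀ i))))
        (ℕ.*-monoʳ-∣ g (k∣y₀ i)))))

·-cross : ∀ {d} p q (u w v : Vecℤ d) → (λ t → q * u t - p * w t) · v ≡ q * (u · v) - p * (w · v)
·-cross p q u w v = trans (·-distribʳ-- (λ t → q * u t) (λ t → p * w t) v)
  (cong₂ _-_ (·-scaleˡ q u v) (·-scaleˡ p w v))

-- The inequalities place f/g between p'/q' and q/p, and these bounds coincide because qq' = pp'.
squeeze : ∀ {p q p' q' f g} → p ≢ 0ℤ → 0ℤ ≤ p → 0ℤ ≤ q' → q * q' ≡ p * p' →
          p * f ≤ g * q → p' * g ≤ f * q' → q' * f ≡ p' * g
squeeze {p} {q} {p'} {q'} {f} {g} p≢0 p≥0 q'≥0 qq'≡pp' pf≤gq p'g≤fq' = ≤-antisym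
  (*-cancelˡ-≤-pos (q' * f) (p' * g) p {{positive (≤∧≢⇒< p≥0 (λ 0≡p → p≢0 (sym 0≡p)))}} (begin
    p * (q' * f)    ≡⟨ rearrange₁ p q' f ⟩
    q' * (p * f)    ≤⟨ *-monoˡ-≤-nonNeg q' {{nonNegative q'≥0}} pf≤gq ⟩
    q' * (g * q)    ≡⟨ rearrange₂ q' g q ⟩
    q * q' * g      ≡⟨ cong (_* g) qq'≡pp' ⟩
    p * p' * g      ≡⟨ *-assoc p p' g ⟩
    p * (p' * g)    ∎))
  (subst (p' * g ≤_) (*-comm f q') p'g≤fq')
  where
  open ≤-Reasoning
  rearrange₁ : ∀ a b c → a * (b * c) ≡ b * (a * c)
  rearrange₁ = solve-∀
  rearrange₂ : ∀ a b c → a * (b * c) ≡ c * a * b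
  rearrange₂ = solve-∀

-- The support forms separate points.

module Separation {d m n s} {ℓ : Fin m → Vecℤ d} {x : Fin n → Vecℤ d} {σ : Fin s → Vecℤ d}
  (fullDim : FullDim ℓ) (pointed : Pointed ℓ) (hilbert : IsHilbertBasis ℓ x)
  (support : AreSupportForms ℓ σ) where

  open HilbertBasis {ℓ = ℓ} {x} fullDim pointed hilbert

  values : Vecℤ d → Fin n → ℤ
  values y i = y · x i

  values≥0 : ∀ {y} → InDual ℓ y → ∀ i → 0ℤ ≤ values y i
  values≥0 y∈D i = y∈D (x i) (x∈C i)

  values≢0 : ∀ {y v} → y · v ≢ 0ℤ → ¬ (∀ i → values y i ≡ 0ℤ)
  values≢0 {y} {v} yv≢0 y≡0 = yv≢0 (·-zeroˡ v (zero-on-x⇒zero {y} y≡0))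

  -- One induction step, with `smaller-vanish` as induction hypothesis. That a form of C* lies in
  -- the smallest face containing y is expressed by its vanishing at every `x i` at which y
  -- vanishes.
  module Face {v y : Vecℤ d}
    (smaller-vanish : ∀ z → InDual ℓ z → #support (values z) ℕ.< #support (values y) → z · v ≡ 0ℤ) where

    -- The form q u - p w is the last point of the dual cone on the way from u in
    -- direction - w, hence lies in a proper face and vanishes at v.
    exchange : ∀ {u w} → InDual ℓ u → InDual ℓ w →
               (∀ i → values y i ≡ 0ℤ → values u i ≡ 0ℤ) → (∀ i → values y i ≡ 0ℤ → values w i ≡ 0ℤ) →
               (∀ i → values w i ≡ 0ℤ) ⊎
               ∃ λ p → ∃ λ q → 0ℤ ≤ p × 0ℤ ≤ q × q ≢ 0ℤ ×
                 (∀ k → p * values w k ≤ values u k * q) × q * (u · v) ≡ p * (w · v)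
    exchange {u} {w} u∈D w∈D u-face w-face
      with min-ratio (values u) (values w) (values≥0 {u} u∈D) (values≥0 {w} w∈D)
    ... | inj₁ w≡0 = inj₁ w≡0
    ... | inj₂ (i , q≢0 , least) =
          inj₂ (p , q , values≥0 {u} u∈D i , values≥0 {w} w∈D i , q≢0 , least ,
            i-j≡0⇒i≡j _ _ (trans (sym (·-cross p q u w v))
              (smaller-vanish z (nonNeg-on-x⇒InDual {z} z≥0)
                (#support-strict z-face i zi≡0 (λ yi≡0 → q≢0 (w-face i yi≡0))))))
      where
      p q : ℤ
      p = values u i
      q = values w i
      z : Vecℤ d
      z t = q * u t - p * w t
      z≥0 : ∀ k → 0ℤ ≤ values z k
      z≥0 k = subst (0ℤ ≤_) (sym (·-cross p q u w (x k)))
        (i≤j⇒0≤j-i (subst (p * values w k ≤_) (*-comm (values u k) q) (least k)))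
      zi≡0 : values z i ≡ 0ℤ
      zi≡0 = trans (·-cross p q u w (x i)) (i≡j⇒i-j≡0 (*-comm q p))
      z-face : ∀ k → values y k ≡ 0ℤ → values z k ≡ 0ℤ
      z-face k yk≡0 = trans (·-cross p q u w (x k)) (trans
        (cong₂ (λ a b → q * a - p * b) (u-face k yk≡0) (w-face k yk≡0))
        (cong₂ _-_ (*-zeroʳ q) (*-zeroʳ p)))

    nonvanishing⇒OnRay : InDual ℓ y → y · v ≢ 0ℤ → ∀ {a} → InDual ℓ a →
                         (∀ i → values y i ≡ 0ℤ → values a i ≡ 0ℤ) → OnRay y a
    nonvanishing⇒OnRay y∈D yv≢0 {a} a∈D a-face
      with exchange {y} {a} y∈D a∈D (λ _ eq → eq) a-face | exchange {a} {y} a∈D y∈D a-face (λ _ eq → eq)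
    ... | _        | inj₁ y≡0 = contradiction y≡0 (values≢0 {y} {v} yv≢0)
    -- Here a is the zero form, which is 0/1 times y.
    ... | inj₁ a≡0 | inj₂ _   = 0 , 1 , +<+ (ℕ.s≤s ℕ.z≤n) ,
          λ t → trans (*-identityˡ (a t)) (zero-on-x⇒zero {a} a≡0 t)
    ... | inj₂ (p , q , p≥0 , q≥0 , q≢0 , pa≤qy , qyv≡pav)
        | inj₂ (p' , q' , p'≥0 , q'≥0 , q'≢0 , p'y≤q'a , q'av≡p'yv) =
          -- Both numbers are nonnegative, so the absolute values only convert them to naturals.
          ∣ p' ∣ , ∣ q' ∣ ,
          subst (0ℤ <_) (sym (0≤i⇒+∣i∣≡i q'≥0)) (≤∧≢⇒< q'≥0 (λ 0≡q' → q'≢0 (sym 0≡q'))) ,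
          λ t → trans (cong (_* a t) (0≤i⇒+∣i∣≡i q'≥0))
                  (trans (q'a≗p'y t) (cong (_* y t) (sym (0≤i⇒+∣i∣≡i p'≥0))))
      where
      open ≡-Reasoning
      rearrange₁ : ∀ a b c → a * b * c ≡ b * (a * c)
      rearrange₁ = solve-∀
      rearrange₂ : ∀ a b c → a * (b * c) ≡ b * (a * c)
      rearrange₂ = solve-∀
      qq'≡pp' : q * q' ≡ p * p'
      qq'≡pp' = *-cancelʳ-≡ (q * q') (p * p') (y · v) {{≢-nonZero yv≢0}} (begin
        q * q' * (y · v)      ≡⟨ rearrange₁ q q' (y · v) ⟩
        q' * (q * (y · v))    ≡⟨ cong (q' *_) qyv≡pav ⟩
        q' * (p * (a · v))    ≡⟨ rearrange₂ q' p (a · v) ⟩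
        p * (q' * (a · v))    ≡⟨ cong (p *_) q'av≡p'yv ⟩
        p * (p' * (y · v))    ≡⟨ *-assoc p p' (y · v) ⟨
        p * p' * (y · v)      ∎)
      p≢0 : p ≢ 0ℤ
      p≢0 p≡0 with i*j≡0⇒i≡0∨j≡0 q (trans qq'≡pp' (trans (cong (_* p') p≡0) (*-zeroˡ p')))
      ... | inj₁ q≡0  = q≢0 q≡0
      ... | inj₂ q'≡0 = q'≢0 q'≡0
      q'a≗p'y : ∀ t → q' * a t ≡ p' * y t
      q'a≗p'y = equal-on-x⇒equal {λ t → q' * a t} {λ t → p' * y t} λ i →
        trans (·-scaleˡ q' a (x i))
          (trans (squeeze p≢0 p≥0 q'≥0 qq'≡pp' (pa≤qy i) (p'y≤q'a i)) (sym (·-scaleˡ p' y (x i))))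

    -- Where y vanishes, the nonnegative values of a and b add up to 0. So both summands lie in the
    -- smallest face containing y, hence on its ray.
    nonvanishing⇒extreme : InDual ℓ y → y · v ≢ 0ℤ → ExtremeRayOfDual ℓ y
    nonvanishing⇒extreme y∈D yv≢0 =
      y∈D , (λ y≡0 → yv≢0 (·-zeroˡ v y≡0)) ,
      λ a b N _ a∈D b∈D a+b≗Ny →
        nonvanishing⇒OnRay y∈D yv≢0 {a} a∈D
          (λ i yi≡0 → +-nonNeg-zeroʳ (values≥0 {b} b∈D i) (values≥0 {a} a∈D i)
            (trans (+-comm (values b i) (values a i)) (sum≡0 a b N a+b≗Ny i yi≡0))) ,
        nonvanishing⇒OnRay y∈D yv≢0 {b} b∈D
          (λ i yi≡0 → +-nonNeg-zeroʳ (values≥0 {a} a∈D i) (values≥0 {b} b∈D i) (sum≡0 a b N a+b≗Ny i yi≡0))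
      where
      sum≡0 : ∀ a b N → (∀ t → a t + b t ≡ + N * y t) → ∀ i → values y i ≡ 0ℤ → values a i + values b i ≡ 0ℤ
      sum≡0 a b N a+b≗Ny i yi≡0 = begin
        values a i + values b i         ≡⟨ ·-distribʳ-+ a b (x i) ⟨
        (λ t → a t + b t) · x i         ≡⟨ ·-congˡ (x i) a+b≗Ny ⟩
        (λ t → + N * y t) · x i         ≡⟨ ·-scaleˡ (+ N) y (x i) ⟩
        + N * values y i                ≡⟨ cong (+ N *_) yi≡0 ⟩
        + N * 0ℤ                        ≡⟨ *-zeroʳ (+ N) ⟩
        0ℤ                              ∎
        where open ≡-Reasoning

  -- The face argument is run on the primitive part y₀ of y, which can be matched with some `σ j`.
  -- It vanishes wherever y does, so its measure is no larger and accessibility of y's measure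
  -- suffices.
  dual-vanishes : ∀ {v} → (∀ j → σ j · v ≡ 0ℤ) → ∀ y → InDual ℓ y → Acc ℕ._<_ (#support (values y)) → y · v ≡ 0ℤ
  dual-vanishes {v} σv≡0 y y∈D (acc smaller) with y · v ≟ 0ℤ
  ... | yes yv≡0 = yv≡0
  ... | no  yv≢0 = contradiction (trans (sym (·-congˡ v σj≗y₀)) (σv≡0 j)) y₀v≢0
    where
    part : ∃ λ (g : ℕ) → ∃ λ (y₀ : Vecℤ d) → g ≢ 0 × (∀ i → y i ≡ + g * y₀ i) × Primitive y₀
    part = primitive-part y (λ y≡0 → yv≢0 (·-zeroˡ v y≡0))
    g : ℕ
    g = proj₁ part
    y₀ : Vecℤ d
    y₀ = proj₁ (proj₂ part)
    instance
      g-nonZero : ℕ.NonZero g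
      g-nonZero = ℕ.≢-nonZero (proj₁ (proj₂ (proj₂ part)))
    y·≡g*y₀· : ∀ w → y · w ≡ + g * (y₀ · w)
    y·≡g*y₀· w = trans (·-congˡ w (proj₁ (proj₂ (proj₂ (proj₂ part))))) (·-scaleˡ (+ g) y₀ w)
    y₀v≢0 : y₀ · v ≢ 0ℤ
    y₀v≢0 y₀v≡0 = yv≢0 (trans (y·≡g*y₀· v) (trans (cong (+ g *_) y₀v≡0) (*-zeroʳ (+ g))))
    y₀∈D : InDual ℓ y₀
    y₀∈D w w∈C = *-cancelˡ-≤-pos 0ℤ (y₀ · w) (+ g) {{positive (+<+ (ℕ.>-nonZero⁻¹ g))}}
      (subst (_≤ + g * (y₀ · w)) (sym (*-zeroʳ (+ g))) (subst (0ℤ ≤_) (y·≡g*y₀· w) (y∈D w w∈C)))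
    y₀-face : ∀ i → values y i ≡ 0ℤ → values y₀ i ≡ 0ℤ
    y₀-face i yi≡0 = *-cancelˡ-≡ (+ g) (values y₀ i) 0ℤ {{g-nonZero}}
      (trans (sym (y·≡g*y₀· (x i))) (trans yi≡0 (sym (*-zeroʳ (+ g)))))
    extreme : ExtremeRayOfDual ℓ y₀
    extreme = Face.nonvanishing⇒extreme {v} {y₀}
      (λ z z∈D z<y₀ → dual-vanishes {v} σv≡0 z z∈D
        (smaller (ℕ.<-≤-trans z<y₀ (#support-mono y₀-face))))
      y₀∈D y₀v≢0
    found : ∃ λ j → σ j ≗ y₀
    found = proj₂ (proj₂ support) y₀ (proj₂ (proj₂ (proj₂ (proj₂ part)))) extreme
    j : Fin s
    j = proj₁ found
    σj≗y₀ : σ j ≗ y₀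
    σj≗y₀ = proj₂ found

  -- The defining forms `ℓ k` belong to C*, so they vanish at v. Then v and -v both lie in the
  -- pointed cone.
  σ-separates : ∀ {v} → (∀ j → σ j · v ≡ 0ℤ) → ∀ t → v t ≡ 0ℤ
  σ-separates {v} σv≡0 = pointed v
    (λ k → ≤-reflexive (sym (ℓv≡0 k)))
    (λ k → ≤-reflexive (sym (trans (·-neg (ℓ k) v) (cong -_ (ℓv≡0 k)))))
    where
    ℓv≡0 : ∀ k → ℓ k · v ≡ 0ℤ
    ℓv≡0 k = dual-vanishes {v} σv≡0 (ℓ k) (λ w w∈C → w∈C k) (<-wellFounded _)

  -- w = Σ xᵢ is an interior point of C, so δ t + N w lies in C for large N.
  x-generates-lattice : ∀ t → ∃ λ (c : Fin n → ℤ) → c ⊙ x ≗ δ t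
  x-generates-lattice t = (λ i → c i - N) , λ r → begin
    ((λ i → c i - N) ⊙ x) r                        ≡⟨ ·-distribʳ-- c (λ _ → N) (λ i → x i r) ⟩
    (c ⊙ x) r - (λ _ → N) · (λ i → x i r)          ≡⟨ cong₂ _-_ (sym (proj₂ (proj₂ rep) r)) (·-congˡ (λ i → x i r) (λ _ → sym (*-identityʳ N))) ⟩
    u r - (λ _ → N * 1ℤ) · (λ i → x i r)           ≡⟨ cong (λ z → u r - z) (·-scaleˡ N (λ _ → 1ℤ) (λ i → x i r)) ⟩
    δ t r + N * w r - N * w r                      ≡⟨ cancel (δ t r) (N * w r) ⟩
    δ t r                                          ∎
    where
    open ≡-Reasoning
    cancel : ∀ a b → a + b - b ≡ a
    cancel = solve-∀
    w : Vecℤ d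
    w = (λ _ → 1ℤ) ⊙ x
    -- One bound for all |`ℓ k · δ t`| at once. Multiplying w by it is enough, since `ℓ k · w` is at
    -- least 1 whenever it is nonzero.
    N : ℤ
    N = ∑ (λ k → + ∣ ℓ k · δ t ∣)
    u : Vecℤ d
    u r = δ t r + N * w r
    ℓw : ∀ k → ℓ k · w ≡ ∑ (λ i → ℓ k · x i)
    ℓw k = trans (·-⊙ (ℓ k) (λ _ → 1ℤ) x) (∑-cong (λ i → *-identityˡ (ℓ k · x i)))
    ℓw≥0 : ∀ k → 0ℤ ≤ ℓ k · w
    ℓw≥0 k = subst (0ℤ ≤_) (sym (ℓw k)) (∑-nonNeg (λ i → x∈C i k))
    -- A vanishing sum of nonnegative terms has vanishing terms, so a form that is zero at w is zero
    -- on the whole basis.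
    ℓw≡0⇒ℓ≡0 : ∀ k → ℓ k · w ≡ 0ℤ → ∀ r → ℓ k r ≡ 0ℤ
    ℓw≡0⇒ℓ≡0 k ℓw≡0 = zero-on-x⇒zero {ℓ k} λ i → ≤-antisym
      (subst (ℓ k · x i ≤_) (trans (sym (ℓw k)) ℓw≡0) (term≤∑ (λ i → x∈C i k) i)) (x∈C i k)
    -i≤∣i∣ : ∀ i → - i ≤ + ∣ i ∣
    -i≤∣i∣ i = subst (λ k → - i ≤ + k) (∣-i∣≡∣i∣ i) (i≤∣i∣ (- i))
      where
      i≤∣i∣ : ∀ i → i ≤ + ∣ i ∣
      i≤∣i∣ (+ _)    = ≤-refl
      i≤∣i∣ -[1+ _ ] = -≤+
    u∈C : InCone ℓ u
    u∈C k with ℓ k · w ≟ 0ℤ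
    ... | yes ℓw≡0 = ≤-reflexive (sym (·-zeroˡ u (ℓw≡0⇒ℓ≡0 k ℓw≡0)))
    ... | no  ℓw≢0 = subst (0ℤ ≤_) (sym ℓu) (subst (_≤ ℓ k · δ t + N * (ℓ k · w)) (+-inverseʳ (ℓ k · δ t))
          (+-monoʳ-≤ (ℓ k · δ t) (≤-trans (-i≤∣i∣ (ℓ k · δ t)) (≤-trans
            (term≤∑ {f = λ k → + ∣ ℓ k · δ t ∣} (λ _ → +≤+ ℕ.z≤n) k) N≤Nℓw))))
      where
      N≥0 : 0ℤ ≤ N
      N≥0 = ∑-nonNeg {f = λ k → + ∣ ℓ k · δ t ∣} (λ _ → +≤+ ℕ.z≤n)
      N≤Nℓw : N ≤ N * (ℓ k · w)
      N≤Nℓw = subst (_≤ N * (ℓ k · w)) (*-identityʳ N)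
        (*-monoˡ-≤-nonNeg N {{nonNegative N≥0}}
          (i<j⇒suc[i]≤j (≤∧≢⇒< (ℓw≥0 k) (λ 0≡ℓw → ℓw≢0 (sym 0≡ℓw)))))
      ℓu : ℓ k · u ≡ ℓ k · δ t + N * (ℓ k · w)
      ℓu = trans (·-comm (ℓ k) u) (trans (·-distribʳ-+ (δ t) (λ r → N * w r) (ℓ k))
        (cong₂ _+_ (·-comm (δ t) (ℓ k)) (trans (·-scaleˡ N w (ℓ k)) (cong (N *_) (·-comm w (ℓ k))))))
    rep : ∃ λ (c : Fin n → ℤ) → (∀ i → 0ℤ ≤ c i) × u ≗ c ⊙ x
    rep = generates {u} u∈C
    c : Fin n → ℤ
    c = proj₁ rep

  -- Every linear relation among the x i holds among the x (Π i), because the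
  -- support forms only see the values σ j (x i).
  admissible-relation : ∀ {Π} → Admissible x σ Π → ∀ {c : Fin n → ℤ} → (∀ t → (c ⊙ x) t ≡ 0ℤ) →
                        ∀ t → (c ⊙ (λ i → x (Π ⟨$⟩ʳ i))) t ≡ 0ℤ
  admissible-relation {Π} (Τ , σx) {c} c⊙x≡0 = σ-separates {c ⊙ xΠ} λ j → begin
    σ j · (c ⊙ xΠ)                                        ≡⟨ ·-⊙ (σ j) c xΠ ⟩
    c · (λ i → σ j · xΠ i)                                ≡⟨ ·-congʳ c (λ i → trans (cong (λ k → σ k · xΠ i) (sym (inverseʳ Τ))) (σx i (Τ ⟨$⟩ˡ j))) ⟩
    c · (λ i → σ (Τ ⟨$⟩ˡ j) · x i)                        ≡⟨ ·-⊙ (σ (Τ ⟨$⟩ˡ j)) c x ⟨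
    σ (Τ ⟨$⟩ˡ j) · (c ⊙ x)                                ≡⟨ ·-zeroʳ (σ (Τ ⟨$⟩ˡ j)) c⊙x≡0 ⟩
    0ℤ                                                    ∎
    where
    open ≡-Reasoning
    xΠ : Fin n → Vecℤ d
    xΠ i = x (Π ⟨$⟩ʳ i)

  -- Automorphisms from admissible permutations.

  Admissible-flip : ∀ Π → Admissible x σ Π → Admissible x σ (flip Π)
  Admissible-flip Π (Τ , σx) = flip Τ , λ i j → trans
    (sym (σx (Π ⟨$⟩ˡ i) (Τ ⟨$⟩ˡ j)))
    (cong₂ (λ k l → σ k · x l) (inverseʳ Τ) (inverseʳ Π))

  admissible-matrix : ∀ Π → Admissible x σ Π → Σ (Matℤ d) λ A → Induces x A Π
  admissible-matrix Π adm = A , induces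
    where
    xΠ : Fin n → Vecℤ d
    xΠ i = x (Π ⟨$⟩ʳ i)
    c : Fin d → Fin n → ℤ
    c k = proj₁ (x-generates-lattice k)
    -- Column k is the forced image of the k-th unit vector: its expansion in the basis with each
    -- `x i` replaced by `x (Π i)`.
    A : Matℤ d
    A t k = (c k ⊙ xΠ) t
    induces : Induces x A Π
    induces i t = begin
      (A *v x i) t               ≡⟨ ·-comm (A t) (x i) ⟩
      x i · (λ k → A t k)        ≡⟨ ⊙-· (x i) c (λ l → xΠ l t) ⟨
      ((x i ⊙ c) ⊙ xΠ) t         ≡⟨ i-j≡0⇒i≡j _ _ (trans (sym (·-distribʳ-- (x i ⊙ c) (δ i) (λ l → xΠ l t)))
                                      (admissible-relation {Π} adm {λ l → (x i ⊙ c) l - δ i l} relation t)) ⟩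
      (δ i ⊙ xΠ) t               ≡⟨ δ-· i (λ l → xΠ l t) ⟩
      xΠ i t                     ∎
      where
      open ≡-Reasoning
      -- Expanding `x i` through the unit vectors gives coefficients `x i ⊙ c`. They may differ from
      -- the trivial ones `δ i`, but the difference is a linear relation, and Π preserves it.
      relation : ∀ r → ((λ l → (x i ⊙ c) l - δ i l) ⊙ x) r ≡ 0ℤ
      relation r = trans (·-distribʳ-- (x i ⊙ c) (δ i) (λ l → x l r)) (i≡j⇒i-j≡0 (begin
        ((x i ⊙ c) ⊙ x) r                  ≡⟨ ⊙-· (x i) c (λ l → x l r) ⟩
        x i · (λ k → (c k ⊙ x) r)          ≡⟨ ·-congʳ (x i) (λ k → proj₂ (x-generates-lattice k) r) ⟩
        x i · (λ k → δ k r)                ≡⟨ ·-δ (x i) r ⟩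
        x i r                              ≡⟨ δ-· i (λ l → x l r) ⟨
        (δ i ⊙ x) r                        ∎))

  -- Row t of AB and the t-th coordinate form agree on the basis, because Π undoes `flip Π`.
  Induces-inverse : ∀ {A B} Π → Induces x A Π → Induces x B (flip Π) → ∀ t k → (A t ⊙ B) k ≡ δ t k
  Induces-inverse {A} {B} Π A-ind B-ind t = equal-on-x⇒equal {A t ⊙ B} {δ t} λ i → begin
    (A t ⊙ B) · x i              ≡⟨ ⊙-· (A t) B (x i) ⟩
    A t · (B *v x i)             ≡⟨ ·-congʳ (A t) (B-ind i) ⟩
    A t · x (Π ⟨$⟩ˡ i)           ≡⟨ A-ind (Π ⟨$⟩ˡ i) t ⟩
    x (Π ⟨$⟩ʳ (Π ⟨$⟩ˡ i)) t      ≡⟨ cong (λ k → x k t) (inverseʳ Π) ⟩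
    x i t                        ≡⟨ δ-· t (x i) ⟨
    δ t · x i                    ∎
    where open ≡-Reasoning

  -- The image of a nonnegative combination has the same coefficients on the permuted basis
  -- elements.
  Induces⇒into : ∀ {A} Π → Induces x A Π → ∀ v → InCone ℓ v → InCone ℓ (A *v v)
  Induces⇒into {A} Π A-ind v v∈C =
    let c , c≥0 , v≗c⊙x = generates {v} v∈C
    in InCone-cong ℓ {c ⊙ (λ i → x (Π ⟨$⟩ʳ i))} {A *v v}
         (λ t → sym (trans (·-congʳ (A t) v≗c⊙x) (trans (·-⊙ (A t) c x) (·-congʳ c (λ i → A-ind i t)))))
         (InCone-⊙ ℓ {c} {λ i → x (Π ⟨$⟩ʳ i)} c≥0 (λ i → x∈C (Π ⟨$⟩ʳ i)))

  admissible⇒aut : ∀ Π → Admissible x σ Π → Σ (Matℤ d) λ A → IsAut ℓ A × Induces x A Π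
  admissible⇒aut Π adm =
    let A , A-ind = admissible-matrix Π adm
        B , B-ind = admissible-matrix (flip Π) (Admissible-flip Π adm)
        AB = Induces-inverse {A} {B} Π A-ind B-ind
        BA = Induces-inverse {B} {A} (flip Π) B-ind A-ind
    in A , ((B , AB , BA) , Induces⇒into {A} Π A-ind ,
         λ w w∈C → B *v w , Induces⇒into {B} (flip Π) B-ind w w∈C , *v-inverse {A = A} {B} AB w) , A-ind

theorem3p6 : (d m n s : ℕ) (ℓ : Fin m → Vecℤ d) (x : Fin n → Vecℤ d) (σ : Fin s → Vecℤ d)
    → FullDim ℓ → Pointed ℓ → IsHilbertBasis ℓ x → AreSupportForms ℓ σ
    → ((A : Matℤ d) → IsAut ℓ A → Σ (Permutation′ n) λ Π → Induces x A Π)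
    × ((A A' : Matℤ d) (Π : Permutation′ n) → IsAut ℓ A → IsAut ℓ A'
    → Induces x A Π → Induces x A' Π → ∀ i j → A i j ≡ A' i j)
    × ((A : Matℤ d) (Π : Permutation′ n) → IsAut ℓ A → Induces x A Π → Admissible x σ Π)
    × ((Π : Permutation′ n) → Admissible x σ Π → Σ (Matℤ d) λ A → IsAut ℓ A × Induces x A Π)
theorem3p6 d m n s ℓ x σ fullDim pointed hilbert support =
  aut-permutes-x ,
  (λ A A' Π _ _ → Induces-injective {A} {A'} {Π}) ,
  aut⇒admissible {x = x} ,
  admissible⇒aut
  where
  open HilbertBasis {ℓ = ℓ} {x} fullDim pointed hilbert
  open SupportForms {ℓ = ℓ} {σ} support
  open Separation {ℓ = ℓ} {x} {σ} fullDim pointed hilbert support
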